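{- For every context $\Gamma$ and formula $A$, if the sequent $\Gamma \longrightarrow A$ is derivable using the rules $*L$, $*R$, $id$, and $cut$, then it has a (closed) derivation using only the rule $*L$ together with the following restricted forms of $*R$ and $id$: - $*R^{\mathrm{foc}}$: from $\Gamma^{\mathrm{irr}} \longrightarrow A$ and $\Delta \longrightarrow B$ infer $\Gamma^{\mathrm{irr}},\Delta \longrightarrow A*B$, where $\Gamma^{\mathrm{irr}}$ ranges over contexts that do not have a product formula $C*D$ at their leftmost end; - $id^{\mathrm{atm}}$: infer $p \longrightarrow p$, where $p$ is an atom.
   Context: Fix a set of atoms. Formulas are generated by: every atom $p$ is a formula, and if $A,B$ are formulas then $A*B$ is a formula. A context ($\Gamma,\Delta,\Theta$) is a possibly empty finite list of formulas; comma denotes concatenation. A sequent $\Gamma \longrightarrow A$ is a pair of a context $\Gamma$ and a formula $A$. The rules of the sequent calculus are: - $*L$: from $A,B,\Delta \longrightarrow C$ infer $A*B,\Delta \longrightarrow C$; - $*R$: from $\Gamma \longrightarrow A$ and $\Delta \longrightarrow B$ infer $\Gamma,\Delta \longrightarrow A*B$; - $id$: infer $A \longrightarrow A$ (no premises); - $cut$: from $\Theta \longrightarrow A$ and $\Gamma,A,\Delta \longrightarrow B$ infer $\Gamma,\Theta,\Delta \longrightarrow B$. A sequent is derivable if it is the conclusion of a closed derivation (a finite tree of rule instances with no undischarged premises). -}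

module Defs where

open import Data.List using (List; _∷_; [_]; _++_)
open import Data.Product using (∃-syntax)
open import Level using (Level)
open import Relation.Binary.PropositionalEquality using (_≡_)
open import Relation.Nullary using (¬_)

infixr 7 _*_
infix  3 _⟶_ _⟶ᶠ_

data Formula {a : Level} (Atom : Set a) : Set a where
  atom : Atom → Formula Atom
  _*_  : Formula Atom → Formula Atom → Formula Atom

Context : {a : Level} → Set a → Set a
Context Atom = List (Formula Atom)

-- The empty context is irreducible.
Irreducible : {a : Level} {Atom : Set a} → Context Atom → Set a
Irreducible Γ = ¬ (∃[ C ] ∃[ D ] ∃[ Δ ] Γ ≡ C * D ∷ Δ)

data _⟶_ {a : Level} {Atom : Set a} : Context Atom → Formula Atom → Set a where
  *L  : ∀ {A B Δ C} → A ∷ B ∷ Δ ⟶ C → A * B ∷ Δ ⟶ C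
  *R  : ∀ {Γ Δ A B} → Γ ⟶ A → Δ ⟶ B → Γ ++ Δ ⟶ A * B
  id  : ∀ {A} → [ A ] ⟶ A
  cut : ∀ {Θ Γ Δ A B} → Θ ⟶ A → Γ ++ [ A ] ++ Δ ⟶ B → Γ ++ Θ ++ Δ ⟶ B

data _⟶ᶠ_ {a : Level} {Atom : Set a} : Context Atom → Formula Atom → Set a where
  *L    : ∀ {A B Δ C} → A ∷ B ∷ Δ ⟶ᶠ C → A * B ∷ Δ ⟶ᶠ C
  *Rfoc : ∀ {Γ Δ A B} → Irreducible Γ → Γ ⟶ᶠ A → Δ ⟶ᶠ B → Γ ++ Δ ⟶ᶠ A * B
  idatm : ∀ {p} → [ atom p ] ⟶ᶠ atom p

{-# OPTIONS --safe #-}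
module Submission where

-- It suffices that focused derivability is closed under the unrestricted
-- rules *R, id and cut (*R-adm, id-adm, cut-adm); *L is already a focused rule.
--
-- Unrestricted *R: permute it above the *L inferences that end the left
-- derivation. The remaining left context is irreducible: it is an atom, or it
-- begins with an irreducible context, which is nonempty because no sequent
-- with an empty context is derivable. Identities then follow by induction on
-- the formula, each product being decomposed by *L.
--
-- Cut: by lexicographic induction on the cut formula A and the two
-- derivations. If some formula stands to the left of A, recurse on the
-- derivation that consumes A: when it ends in *Rfoc and A lies in the
-- irreducible context, the head of that context is not A, so it survives the
-- substitution and *Rfoc can be reapplied. If A is leftmost (cut-head), recurse
-- on the derivation that produces A: *L permutes below the cut, and if the last
-- rule is *Rfoc then A is a product A₁ * A₂. Focusing forces a derivation from
-- a leftmost product to end in *L (*L⁻¹), so the cut is principal and reduces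
-- to cuts on A₂ and on A₁.

open import Defs
open import Data.Empty using (⊥-elim)
open import Data.List using (List; []; _∷_; [_]; _++_)
open import Data.List.Properties using (++-assoc; ∷-injective)
open import Data.Product using (∃-syntax; _×_; _,_)
open import Data.Sum using (_⊎_; inj₁; inj₂)
open import Level using (Level)
open import Relation.Binary.PropositionalEquality using (_≡_; refl; cong; subst; sym; trans)
open import Relation.Nullary using (¬_)

private
  variable
    a : Level
    Atom : Set a
    A B C : Formula Atom
    Γ Δ Θ Ξ : Context Atom

-- A formula occurrence in a concatenation lies in the left or the right part.
++-split : {X : Set a} (us : List X) {vs : List X} (xs : List X) {x : X} {ys : List X} →
           us ++ vs ≡ xs ++ x ∷ ys →
           (∃[ zs ] us ≡ xs ++ x ∷ zs × ys ≡ zs ++ vs) ⊎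
           (∃[ zs ] xs ≡ us ++ zs × vs ≡ zs ++ x ∷ ys)
++-split []       xs       eq   = inj₂ (xs , refl , eq)
++-split (u ∷ us) []       refl = inj₁ (us , refl , refl)
++-split (u ∷ us) (x ∷ xs) eq   with ∷-injective eq
... | refl , eq′ with ++-split us xs eq′
...   | inj₁ (zs , us≡ , ys≡) = inj₁ (zs , cong (u ∷_) us≡ , ys≡)
...   | inj₂ (zs , xs≡ , vs≡) = inj₂ (zs , cong (u ∷_) xs≡ , vs≡)

irreducible-head : Irreducible (A ∷ Γ) → Irreducible (A ∷ Δ)
irreducible-head irr (C , D , _ , refl) = irr (C , D , _ , refl)

context-nonempty : Γ ⟶ᶠ A → ¬ (Γ ≡ [])
context-nonempty (*Rfoc {[]}    _ d _) _  = context-nonempty d refl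
context-nonempty (*Rfoc {_ ∷ _} _ _ _) ()

*R-adm : Γ ⟶ᶠ A → Δ ⟶ᶠ B → Γ ++ Δ ⟶ᶠ A * B
*R-adm (*L d) e = *L (*R-adm d e)
*R-adm (*Rfoc {[]} _ d _) e = ⊥-elim (context-nonempty d refl)
*R-adm (*Rfoc {_ ∷ _} irr d₁ d₂) e = *Rfoc (irreducible-head irr) (*Rfoc irr d₁ d₂) e
*R-adm idatm e = *Rfoc (λ ()) idatm e

id-adm : (A : Formula Atom) → [ A ] ⟶ᶠ A
id-adm (atom p) = idatm
id-adm (A * B)  = *L (*R-adm (id-adm A) (id-adm B))

-- Focusing leaves *L as the only possible last rule below a leftmost product.
-- The context is a variable with an equation, since the context in the
-- conclusion of *Rfoc is a concatenation, which does not unify with a cons.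
*L⁻¹ : Ξ ⟶ᶠ C → Ξ ≡ A * B ∷ Δ → A ∷ B ∷ Δ ⟶ᶠ C
*L⁻¹ (*L d)                    refl = d
*L⁻¹ (*Rfoc {[]}    _ d _)     _    = ⊥-elim (context-nonempty d refl)
*L⁻¹ (*Rfoc {_ ∷ _} irr _ _)   refl = ⊥-elim (irr (_ , _ , _ , refl))

-- Admissibility of cut, on a leftmost formula and on an arbitrary one.
-- As in *L⁻¹, an equation describes the context of the second derivation in
-- cut-adm, so that recursion on that derivation is structural.
cut-head : (A : Formula Atom) → Θ ⟶ᶠ A → A ∷ Δ ⟶ᶠ B → Θ ++ Δ ⟶ᶠ B
cut-adm  : (A : Formula Atom) → Θ ⟶ᶠ A → (Γ : Context Atom) →
           Ξ ⟶ᶠ B → Ξ ≡ Γ ++ A ∷ Δ → Γ ++ Θ ++ Δ ⟶ᶠ B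

cut-head A        (*L d) e = *L (cut-head A d e)
cut-head (atom _) idatm  e = e
-- Principal cut: A₂ is cut first, so that A₁ is leftmost for the second cut.
cut-head {Δ = Δ} {B = B} (A₁ * A₂) (*Rfoc {Γ₁} {Γ₂} _ d₁ d₂) e =
  subst (_⟶ᶠ B) (sym (++-assoc Γ₁ Γ₂ Δ))
    (cut-head A₁ d₁ (cut-adm A₂ d₂ [ A₁ ] (*L⁻¹ e refl) refl))

cut-adm A d []      e      refl = cut-head A d e
cut-adm A d (_ ∷ Γ) (*L e) refl = *L (cut-adm A d (_ ∷ _ ∷ Γ) e refl)
cut-adm {Θ = Θ} {B = B} A d (G ∷ Γ) (*Rfoc {Γ₁} {Γ₂} irr e₁ e₂) eq with ++-split Γ₁ (G ∷ Γ) eq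
... | inj₁ (Δ₁ , refl , refl) =
  subst (_⟶ᶠ B) (cong (G ∷_) assoc)
    (*Rfoc (irreducible-head irr) (cut-adm A d (G ∷ Γ) e₁ refl) e₂)
  where
  assoc : (Γ ++ Θ ++ Δ₁) ++ Γ₂ ≡ Γ ++ Θ ++ Δ₁ ++ Γ₂
  assoc = trans (++-assoc Γ (Θ ++ Δ₁) Γ₂) (cong (Γ ++_) (++-assoc Θ Δ₁ Γ₂))
... | inj₂ (Γ′ , G∷Γ≡ , Γ₂≡) =
  subst (_⟶ᶠ B) assoc (*Rfoc irr e₁ (cut-adm A d Γ′ e₂ Γ₂≡))
  where
  assoc : ∀ {Λ} → Γ₁ ++ Γ′ ++ Λ ≡ G ∷ Γ ++ Λ
  assoc {Λ} = trans (sym (++-assoc Γ₁ Γ′ Λ)) (cong (_++ Λ) (sym G∷Γ≡))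
cut-adm A d (_ ∷ [])    idatm ()
cut-adm A d (_ ∷ _ ∷ _) idatm ()

claimI2 : {a : Level} {Atom : Set a} (Γ : Context Atom) (A : Formula Atom) → Γ ⟶ A → Γ ⟶ᶠ A
claimI2 _ _ (*L d)               = *L (claimI2 _ _ d)
claimI2 _ _ (*R d e)             = *R-adm (claimI2 _ _ d) (claimI2 _ _ e)
claimI2 _ _ (id {A})             = id-adm A
claimI2 _ _ (cut {Γ = Γ} {A = A} d e) = cut-adm A (claimI2 _ _ d) Γ (claimI2 _ _ e) refl
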